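{- For every theory $\Gamma$ and every sentence $\varphi$ of $\mathcal{L}_2$: if $\Gamma\models\varphi$, then $\Gamma\vdash\varphi$, where $\vdash$ is provability in the system consisting of the rules (axiom), (barbara), (anti), (some$_1$), (some$_2$), (darii) together with the rule (cases).
   Context: Syntax of $\mathcal{L}_2$. Fix a set $P$ of nouns and a set $R$ of verbs. Terms: every noun $p\in P$ is a term; if $r\in R$ and $x$ is a term then $(r\ \mathsf{all}\ x)$ is a term. Sentences: $(\mathsf{all}\ x\ y)$ and $(\mathsf{some}\ x\ y)$ for terms $x,y$. A theory is a set of sentences. Semantics. A model $\mathcal{M}$ is a set $M$ (possibly empty) with $[\![p]\!]\subseteq M$ for $p\in P$ and $[\![r]\!]\subseteq M\times M$ for $r\in R$; $[\![r\ \mathsf{all}\ x]\!]=\{m\in M: m\,[\![r]\!]\,n\text{ for all }n\in[\![x]\!]\}$. $\mathcal{M}\models(\mathsf{all}\ x\ y)$ iff $[\![x]\!]\subseteq[\![y]\!]$; $\mathcal{M}\models(\mathsf{some}\ x\ y)$ iff $[\![x]\!]\cap[\![y]\!]\neq\emptyset$. $\Gamma\models\varphi$ means every model of $\Gamma$ satisfies $\varphi$. Rules (for all terms $x,y,z$ and verbs $r$): (axiom) infer $(\mathsf{all}\ x\ x)$ from no premises; (barbara) from $(\mathsf{all}\ x\ y)$ and $(\mathsf{all}\ y\ z)$ infer $(\mathsf{all}\ x\ z)$; (anti) from $(\mathsf{all}\ x\ y)$ infer $(\mathsf{all}\ (r\ \mathsf{all}\ y)\ (r\ \mathsf{all}\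 x))$; (some$_1$) from $(\mathsf{some}\ x\ y)$ infer $(\mathsf{some}\ x\ x)$; (some$_2$) from $(\mathsf{some}\ x\ y)$ infer $(\mathsf{some}\ y\ x)$; (darii) from $(\mathsf{some}\ x\ y)$ and $(\mathsf{all}\ y\ z)$ infer $(\mathsf{some}\ x\ z)$. (cases): for any sentence $\varphi$, terms $x,y$ and verb $r$: given a derivation of $\varphi$ from $\Gamma\cup\{(\mathsf{some}\ x\ x)\}$ and a derivation of $\varphi$ from $\Gamma\cup\{(\mathsf{all}\ y\ (r\ \mathsf{all}\ x))\}$, one concludes $\varphi$ from $\Gamma$ (the assumptions $(\mathsf{some}\ x\ x)$ and $(\mathsf{all}\ y\ (r\ \mathsf{all}\ x))$ are withdrawn; zero or more occurrences may be withdrawn). $\Gamma\vdash\varphi$ means that there is a finite derivation of $\varphi$ using these rules whose non-withdrawn assumptions belong to $\Gamma$. -}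

module Defs where

open import Level using (Level; suc)
open import Relation.Unary using (Pred; _∈_; _⊆_; _∪_; _∩_; ｛_｝; Satisfiable)
open import Relation.Binary.Core using (Rel)

-- P is the set of nouns and R the set of verbs.
data Term {ℓ : Level} (P R : Set ℓ) : Set ℓ where
  noun    : P → Term P R
  _-all-_ : R → Term P R → Term P R

data Sentence {ℓ : Level} (P R : Set ℓ) : Set ℓ where
  all some : Term P R → Term P R → Sentence P R

Theory : {ℓ : Level} (P R : Set ℓ) → Set (suc ℓ)
Theory {ℓ} P R = Pred (Sentence P R) ℓ

record Model {ℓ : Level} (P R : Set ℓ) : Set (suc ℓ) where
  field
    Carrier : Set ℓ
    nounᴹ   : P → Pred Carrier ℓ
    verbᴹ   : R → Rel Carrier ℓ

  ⟦_⟧ : Term P R → Pred Carrier ℓ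
  ⟦ noun p ⟧    = nounᴹ p
  ⟦ r -all- x ⟧ = λ m → ∀ n → n ∈ ⟦ x ⟧ → verbᴹ r m n

infix 4 _⊨ˢ_ _⊨ᵗ_ _⊨_ _⊢_

_⊨ˢ_ : {ℓ : Level} {P R : Set ℓ} → Model P R → Sentence P R → Set ℓ
M ⊨ˢ all x y  = ⟦ x ⟧ ⊆ ⟦ y ⟧                 where open Model M
M ⊨ˢ some x y = Satisfiable (⟦ x ⟧ ∩ ⟦ y ⟧)   where open Model M

_⊨ᵗ_ : {ℓ : Level} {P R : Set ℓ} → Model P R → Theory P R → Set ℓ
M ⊨ᵗ Γ = ∀ ψ → ψ ∈ Γ → M ⊨ˢ ψ

_⊨_ : {ℓ : Level} {P R : Set ℓ} → Theory P R → Sentence P R → Set (suc ℓ)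
_⊨_ {P = P} {R = R} Γ φ = (M : Model P R) → M ⊨ᵗ Γ → M ⊨ˢ φ

-- Γ collects the assumptions not withdrawn; since membership in Γ ∪ ｛ ψ ｝
-- may be used any number of times, cases withdraws zero or more occurrences.
data _⊢_ {ℓ : Level} {P R : Set ℓ} (Γ : Theory P R) : Sentence P R → Set ℓ where
  assumption : ∀ {φ} → φ ∈ Γ → Γ ⊢ φ
  axiom      : ∀ {x} → Γ ⊢ all x x
  barbara    : ∀ {x y z} → Γ ⊢ all x y → Γ ⊢ all y z → Γ ⊢ all x z
  anti       : ∀ {x y r} → Γ ⊢ all x y → Γ ⊢ all (r -all- y) (r -all- x)
  some₁      : ∀ {x y} → Γ ⊢ some x y → Γ ⊢ some x x
  some₂      : ∀ {x y} → Γ ⊢ some x y → Γ ⊢ some y x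
  darii      : ∀ {x y z} → Γ ⊢ some x y → Γ ⊢ all y z → Γ ⊢ some x z
  cases      : ∀ {φ x y r} →
               (Γ ∪ ｛ some x x ｝) ⊢ φ →
               (Γ ∪ ｛ all y (r -all- x) ｝) ⊢ φ →
               Γ ⊢ φ

{-# OPTIONS --safe #-}
module Submission where

-- Fix Γ and φ, and write A for Γ ⊢ φ.  The proof builds one model of Γ whose
-- satisfaction of φ yields A.
--
-- The idea is that a rule uses at most one existential premise, so that terms
-- which can be assumed inhabited one at a time without proving φ can be assumed
-- inhabited all at once.  Call a term e refuted when Γ together with some e e
-- proves φ.  For a refuted e the rule cases makes every sentence
-- all y (r all e) available for free in a proof of φ (eliminate).  Closing Γ
-- and these sentences under axiom, barbara and anti gives a preorder ≼ on
-- terms.  Classically, the points of the model are the pairs (u , v) such that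
-- Γ together with some u v does not prove φ; such a pair lies in z when u ≼ z
-- or v ≼ z.  A term z is either refuted, and then everything is below every
-- r all z, or it is not, and then (z , z) is a generic element of z; either way
-- (u , v) lies in r all z exactly when u or v is below r all z (truth).
--
-- To avoid deciding whether a term is refuted, and to have no need of an
-- argument by contradiction, falsity is replaced by A throughout: a point is a
-- pair for which refutation implies A, and membership is double negated
-- relative to A.
--
-- If φ is some x y, a witness of φ in the model is a pair (u , v) from which
-- φ is derivable, hence a refuted pair, so A holds.  If φ is all x y, then
-- (x , x) is a point, because existential assumptions are useless for proving
-- universal sentences (universal-part), and its membership in y gives x ≼ y,
-- whence A.

open import Defs
open import Level using (Level)
open import Data.Product using (Σ-syntax; ∃-syntax; _×_; _,_; proj₁; proj₂)
open import Data.Sum using (_⊎_; inj₁; inj₂; map; map₁)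
open import Function using (id; _∘_; _⇔_; mk⇔; Equivalence)
open import Relation.Binary.PropositionalEquality using (refl)
open import Relation.Unary using (_∈_; _⊆_; _∪_; ｛_｝)

private
  variable
    ℓ : Level
    P R : Set ℓ
    Γ Δ : Theory P R
    φ : Sentence P R
    x y u v : Term P R

weaken : Γ ⊆ Δ → Γ ⊢ φ → Δ ⊢ φ
weaken s (assumption h) = assumption (s h)
weaken s axiom          = axiom
weaken s (barbara d e)  = barbara (weaken s d) (weaken s e)
weaken s (anti d)       = anti (weaken s d)
weaken s (some₁ d)      = some₁ (weaken s d)
weaken s (some₂ d)      = some₂ (weaken s d)
weaken s (darii d e)    = darii (weaken s d) (weaken s e)
weaken s (cases d e)    = cases (weaken (map₁ s) d) (weaken (map₁ s) e)

some-mono : Γ ⊢ some u v → Γ ⊢ all u x → Γ ⊢ all v y → Γ ⊢ some x y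
some-mono s d e = some₂ (darii (some₂ (darii s e)) d)

-- An element common to u and v lies in x and in y as soon as each of x and y
-- contains u or v.
some-above : Γ ⊢ some u v → Γ ⊢ all u x ⊎ Γ ⊢ all v x →
             Γ ⊢ all u y ⊎ Γ ⊢ all v y → Γ ⊢ some x y
some-above s (inj₁ d) (inj₁ e) = some-mono (some₁ s) d e
some-above s (inj₁ d) (inj₂ e) = some-mono s d e
some-above s (inj₂ d) (inj₁ e) = some-mono (some₂ s) d e
some-above s (inj₂ d) (inj₂ e) = some-mono (some₁ (some₂ s)) d e

-- An application of cases with a universal conclusion is redundant: its first
-- branch adds only an existential assumption.
universal-part : (∀ {u v} → all u v ∈ Δ → all u v ∈ Γ) →
                 Δ ⊢ all x y → Γ ⊢ all x y
universal-part s (assumption h) = assumption (s h)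
universal-part s axiom          = axiom
universal-part s (barbara d e)  = barbara (universal-part s d) (universal-part s e)
universal-part s (anti d)       = anti (universal-part s d)
universal-part s (cases d _)    = universal-part (λ { (inj₁ h) → s h ; (inj₂ ()) }) d

module Canonical {ℓ : Level} {P R : Set ℓ} (Γ : Theory P R) (φ : Sentence P R) where

  -- Negation and double negation with Γ ⊢ φ in the place of falsity.
  ¬ᴬ_ ¬¬ᴬ_ : Set ℓ → Set ℓ
  ¬ᴬ  X = X → Γ ⊢ φ
  ¬¬ᴬ X = ¬ᴬ (¬ᴬ X)

  ¬¬ᴬ-map : ∀ {X Y : Set ℓ} → (X → Y) → ¬¬ᴬ X → ¬¬ᴬ Y
  ¬¬ᴬ-map f h k = h (k ∘ f)

  -- The pair (u , v) is refuted when assuming that u and v have a common element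
  -- proves φ; a single term e is refuted when the pair (e , e) is.
  Refuted : Term P R → Term P R → Set ℓ
  Refuted u v = (Γ ∪ ｛ some u v ｝) ⊢ φ

  infix 4 _≼_ _⊑_

  -- Inclusions that follow from Γ when refuted terms are taken to be empty.
  data _≼_ : Term P R → Term P R → Set ℓ where
    given   : ∀ {x y} → all x y ∈ Γ → x ≼ y
    vacuous : ∀ {e y r} → Refuted e e → y ≼ r -all- e
    ≼-refl  : ∀ {x} → x ≼ x
    ≼-trans : ∀ {x y z} → x ≼ y → y ≼ z → x ≼ z
    ≼-anti  : ∀ {x y r} → x ≼ y → r -all- y ≼ r -all- x

  -- In a proof of φ from any Δ extending Γ, the inclusion x ≼ y may be used as
  -- though all x y were provable.  Each use of vacuous becomes an application
  -- of cases, which enlarges the theory; hence the hypothesis about all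
  -- extensions of Δ.
  eliminate : ∀ {x y} {Δ : Theory P R} → x ≼ y → Γ ⊆ Δ →
              (∀ {Δ′ : Theory P R} → Δ ⊆ Δ′ → Δ′ ⊢ all x y → Δ′ ⊢ φ) → Δ ⊢ φ
  eliminate (given h)     s k = k id (assumption (s h))
  eliminate (vacuous b)   s k = cases (weaken (map₁ s) b) (k inj₁ (assumption (inj₂ refl)))
  eliminate ≼-refl        s k = k id axiom
  eliminate (≼-trans p q) s k =
    eliminate p s λ s₁ d →
    eliminate q (s₁ ∘ s) λ s₂ e →
    k (s₂ ∘ s₁) (barbara (weaken s₂ d) e)
  eliminate (≼-anti p)    s k = eliminate p s λ s₁ d → k s₁ (anti d)

  -- Points of the model: pairs of terms that are not refuted, in the sense of ¬ᴬ.
  Point : Set ℓ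
  Point = Σ[ u ∈ Term P R ] Σ[ v ∈ Term P R ] ¬ᴬ Refuted u v

  -- The point (u , v) is below z when u or v is: as a common element of u and v,
  -- it belongs to every term above either of them.
  _⊑_ : Point → Term P R → Set ℓ
  (u , v , _) ⊑ z = u ≼ z ⊎ v ≼ z

  ⊑-trans : ∀ m {x y} → m ⊑ x → x ≼ y → m ⊑ y
  ⊑-trans _ p q = map (λ p′ → ≼-trans p′ q) (λ p′ → ≼-trans p′ q) p

  -- Up to double negation, the verb r holds from m to n when n is below some w
  -- such that m is below r all w.
  canonical : Model P R
  canonical = record
    { Carrier = Point
    ; nounᴹ   = λ p m → ¬¬ᴬ (m ⊑ noun p)
    ; verbᴹ   = λ r m n → ¬¬ᴬ (∃[ w ] m ⊑ r -all- w × n ⊑ w)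
    }

  open Model canonical using (⟦_⟧)

  -- The truth lemma: membership in a term is its description by ⊑, up to double
  -- negation, for every term and not just for nouns.
  truth : ∀ z m → m ∈ ⟦ z ⟧ ⇔ ¬¬ᴬ (m ⊑ z)
  truth (noun p)    m = mk⇔ id id
  truth (r -all- z) m = mk⇔ to from
    where
    -- If z is refuted then m ⊑ r -all- z by vacuous.  So the assumption k, that
    -- m ⊑ r -all- z fails, makes (z , z) a point; it is in z, so m is related
    -- to it, and this contradicts k.
    to : m ∈ ⟦ r -all- z ⟧ → ¬¬ᴬ (m ⊑ r -all- z)
    to h k = h generic (Equivalence.from (truth z generic) λ l → l (inj₁ ≼-refl))
               λ { (w , p , inj₁ q) → k (⊑-trans m p (≼-anti q))
                 ; (w , p , inj₂ q) → k (⊑-trans m p (≼-anti q)) }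
      where
      generic : Point
      generic = z , z , λ b → k (inj₁ (vacuous b))

    from : ¬¬ᴬ (m ⊑ r -all- z) → m ∈ ⟦ r -all- z ⟧
    from h n n∈z k = h λ p → Equivalence.to (truth z n) n∈z λ q → k (z , p , q)

  module _ {z : Term P R} {m : Point} where
    open Equivalence (truth z m) public using () renaming (to to below; from to member)

  -- If some x y belongs to Γ then the pair (x , y) is not refuted, because the
  -- extra assumption is already there.
  canonical-⊨ : canonical ⊨ᵗ Γ
  canonical-⊨ (all x y)  h {m} m∈x =
    member (¬¬ᴬ-map (λ p → ⊑-trans m p (given h)) (below {x} m∈x))
  canonical-⊨ (some x y) h =
    m , member {x} (λ k → k (inj₁ ≼-refl)) , member {y} (λ k → k (inj₂ ≼-refl))
    where
    m : Point
    m = x , y , weaken λ { (inj₁ g) → g ; (inj₂ refl) → h }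

  -- As for eliminate, with m ⊑ x in place of a single inclusion of terms.
  eliminate-⊑ : ∀ m {x} {Δ : Theory P R} → m ⊑ x → Γ ⊆ Δ →
                (∀ {Δ′ : Theory P R} → Δ ⊆ Δ′ →
                   Δ′ ⊢ all (proj₁ m) x ⊎ Δ′ ⊢ all (proj₁ (proj₂ m)) x → Δ′ ⊢ φ) →
                Δ ⊢ φ
  eliminate-⊑ _ (inj₁ p) s k = eliminate p s λ s₁ d → k s₁ (inj₁ d)
  eliminate-⊑ _ (inj₂ p) s k = eliminate p s λ s₁ d → k s₁ (inj₂ d)

open Canonical

-- In its canonical model a sentence holds only if it is provable.
canonical-complete : (Γ : Theory P R) (φ : Sentence P R) → canonical Γ φ ⊨ˢ φ → Γ ⊢ φ
canonical-complete Γ φ@(all x y) h =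
  below Γ φ {y} (h {m} (member Γ φ {x} λ k → k (inj₁ ≼-refl)))
    λ { (inj₁ p) → eliminate Γ φ p id (λ _ d → d)
      ; (inj₂ p) → eliminate Γ φ p id (λ _ d → d) }
  where
  m : Point Γ φ
  -- Here the existential assumption some x x is discarded.
  m = x , x , universal-part λ { (inj₁ g) → g ; (inj₂ ()) }
canonical-complete Γ φ@(some x y) (m@(u , v , unrefuted) , m∈x , m∈y) =
  below Γ φ {x} m∈x λ p →
  below Γ φ {y} m∈y λ q →
  -- The pair (u , v) is refuted, since some u v now yields some x y.
  unrefuted
    (eliminate-⊑ Γ φ m p inj₁ λ s₁ d →
     eliminate-⊑ Γ φ m q (s₁ ∘ inj₁) λ s₂ e →
     some-above (assumption (s₂ (s₁ (inj₂ refl)))) (map (weaken s₂) (weaken s₂) d) e)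

theorem2p20 : {ℓ : Level} {P R : Set ℓ} (Γ : Theory P R) (φ : Sentence P R) → Γ ⊨ φ → Γ ⊢ φ
theorem2p20 Γ φ h = canonical-complete Γ φ (h (canonical Γ φ) (canonical-⊨ Γ φ))
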